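{- Let $a,d\in\mathbb C$ and let $n\in\mathbb C$ with $d-n\in\mathbb N$. Then the polynomial $$f(a,d,n)_x=\sum_{k=0}^{d-n}\binom{a+d+x-k}{k}\binom{d+k-x}{d-n-k}\in\mathbb C[x]$$ is constant in $x$; its value depends only on $a$, $d$ and $n$.
   Context: For $z\in\mathbb C$ (or $z$ a polynomial in $x$) and $k\in\mathbb N$, the binomial coefficient is $\binom{z}{k}=\frac{z(z-1)\cdots(z-k+1)}{k!}$. -}

module Defs where

open import Algebra.Apartness.Bundles using (HeytingField; HeytingCommutativeRing)
open import Algebra.Bundles using (CommutativeRing; RawRing)
open import Algebra.Definitions.RawSemiring using (sum)
open import Data.Fin.Base using (toℕ)
open import Data.List.Base using (List; []; _∷_; map)
open import Data.Nat.Base as ℕ using (ℕ; zero; suc; _∸_; _!; NonZero)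
open import Data.Nat.Properties using (_!≢0)
open import Data.Product.Base using (Σ; _,_; proj₁)
open import Level using (_⊔_) renaming (suc to lsuc)

import Algebra.Properties.Monoid.Mult as Mult

-- Fields of characteristic zero, ℂ being the motivating instance.  The
-- hypothesis is phrased with apartness, which is what a Heyting field needs
-- in order to invert the positive integers.
record CharacteristicZeroField c ℓ₁ ℓ₂ : Set (lsuc (c ⊔ ℓ₁ ⊔ ℓ₂)) where
  field
    heytingField : HeytingField c ℓ₁ ℓ₂

  open HeytingField heytingField public

  commutativeRing : CommutativeRing c ℓ₁
  commutativeRing = HeytingCommutativeRing.commutativeRing heytingCommutativeRing

  open Mult (CommutativeRing.+-monoid commutativeRing) public using (_×_)

  field
    characteristicZero : ∀ n .{{_ : NonZero n}} → (n × 1#) # 0#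

  -- #⇒invertible yields an inverse of n - 0; since n - 0 ≈ n, this is an
  -- inverse of n.
  1/ : ∀ n .{{_ : NonZero n}} → Carrier
  1/ n = proj₁ (#⇒invertible (characteristicZero n))

module Polynomials {c ℓ₁ ℓ₂} (K : CharacteristicZeroField c ℓ₁ ℓ₂) where

  open CharacteristicZeroField K

  -- c₀ ∷ c₁ ∷ … represents c₀ + c₁ x + …; trailing zeros are allowed, so
  -- equality of polynomials is equality of all coefficients.
  Poly : Set c
  Poly = List Carrier

  coeff : Poly → ℕ → Carrier
  coeff []       _       = 0#
  coeff (c₀ ∷ _) zero    = c₀
  coeff (_ ∷ p)  (suc i) = coeff p i

  infix  4 _≈ₚ_
  infixl 6 _+ₚ_ _-ₚ_
  infixl 7 _*ₚ_
  infixr 7 _∙ₚ_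
  infix  8 -ₚ_

  _≈ₚ_ : Poly → Poly → Set ℓ₁
  p ≈ₚ q = ∀ i → coeff p i ≈ coeff q i

  const : Carrier → Poly
  const s = s ∷ []

  X : Poly
  X = 0# ∷ 1# ∷ []

  _+ₚ_ : Poly → Poly → Poly
  []      +ₚ q       = q
  (s ∷ p) +ₚ []      = s ∷ p
  (s ∷ p) +ₚ (t ∷ q) = (s + t) ∷ (p +ₚ q)

  -ₚ_ : Poly → Poly
  -ₚ_ = map (λ s → - s)

  _-ₚ_ : Poly → Poly → Poly
  p -ₚ q = p +ₚ (-ₚ q)

  _∙ₚ_ : Carrier → Poly → Poly
  s ∙ₚ p = map (s *_) p

  _*ₚ_ : Poly → Poly → Poly
  []      *ₚ q = []
  (s ∷ p) *ₚ q = s ∙ₚ q +ₚ (0# ∷ (p *ₚ q))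

  polyRawRing : RawRing c ℓ₁
  polyRawRing = record
    { Carrier = Poly
    ; _≈_     = _≈ₚ_
    ; _+_     = _+ₚ_
    ; _*_     = _*ₚ_
    ; -_      = -ₚ_
    ; 0#      = []
    ; 1#      = const 1#
    }

  open RawRing polyRawRing using (rawSemiring)

  nat : ℕ → Poly
  nat k = const (k × 1#)

  -- z (z - 1) ⋯ (z - k + 1)
  fallingFactorial : Poly → ℕ → Poly
  fallingFactorial z zero    = const 1#
  fallingFactorial z (suc k) = fallingFactorial z k *ₚ (z -ₚ nat k)

  binomial : Poly → ℕ → Poly
  binomial z k = 1/ (k !) {{k !≢0}} ∙ₚ fallingFactorial z k

  -- z ∈ ℕ.  In characteristic zero the natural number is determined by z.
  IsNatural : Carrier → Set ℓ₁
  IsNatural z = Σ ℕ λ m → z ≈ m × 1#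

  -- n enters only through the natural number m = d - n; the index k runs over
  -- Fin (suc m), that is 0 ≤ k ≤ m, so the truncated m ∸ k is d - n - k.
  f : (a d n : Carrier) → IsNatural (d - n) → Poly
  f a d n (m , _) = sum rawSemiring {suc m} λ i → let k = toℕ i in
    binomial (const a +ₚ const d +ₚ X -ₚ nat k) k
      *ₚ binomial (const d +ₚ nat k -ₚ X) (m ∸ k)

{-# OPTIONS --safe #-}

-- Write y = a + d + x and z = d - x, so that f at x is the Jensen-type sum
-- S m y z = ∑ₖ C(y - k, k) C(z + k, m - k) with m = d - n.  Pascal's rule,
-- applied to either factor, gives
--   S (m+1) (y+1) z = S (m+1) y z + S m (y-1) (z+1),
--   S (m+1) y (z+1) = S (m+1) y z + S m y z,
-- whence S m (y+1) z = S m y (z+1) by induction on m.  Thus f takes the same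
-- value at x and x + 1, hence at all natural numbers, and a polynomial doing
-- so over a field of characteristic zero is constant.
module Submission where

open import Defs
open import Data.Product.Base using (Σ-syntax) renaming (_×_ to _∧_)

open import Algebra.Apartness.Bundles using (HeytingField)
open import Algebra.Bundles using (CommutativeRing; RawRing)
import Algebra.Apartness.Properties.HeytingCommutativeRing as HeytingProperties
import Algebra.Definitions.RawSemiring as RawSemiringDefinitions
import Algebra.Properties.Ring as RingProperties
import Algebra.Properties.Semiring.Mult as SemiringMult
import Algebra.Properties.Semiring.Sum as SemiringSum
import Algebra.Solver.Ring.NaturalCoefficients.Default as SemiringSolver
open import Data.Empty using (⊥-elim)
open import Data.Fin.Base as Fin using (Fin; toℕ; fromℕ; inject₁)
open import Data.Fin.Properties using (toℕ-inject₁; toℕ-fromℕ; toℕ≤pred[n])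
open import Data.List.Base using ([]; _∷_; length)
open import Data.Nat.Base as ℕ using (ℕ; zero; suc; _∸_; _!; NonZero)
open import Data.Nat.Properties as ℕ using (_!≢0)
open import Data.Product.Base using (_,_; proj₁; proj₂)
open import Function.Base using (_∘_)
open import Relation.Binary.PropositionalEquality.Core as ≡ using (_≡_)
import Relation.Binary.Reasoning.Setoid as SetoidReasoning

module _ {c ℓ₁ ℓ₂} (K : CharacteristicZeroField c ℓ₁ ℓ₂) where

  open CharacteristicZeroField K
    using (heytingField; characteristicZero; 1/; #-irrefl; #⇒invertible)
    renaming (commutativeRing to R)
  open CommutativeRing R
  open Polynomials K
  open HeytingProperties (HeytingField.heytingCommutativeRing heytingField)
    using (x-0≈x)
  open RingProperties ring
    using (-0#≈0#; -‿+-comm; -‿distribʳ-*; +-cancelˡ; +-identityʳ-unique; xyx⁻¹≈y)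
  open SemiringMult semiring using (_×_; ×1-homo-*)
  open SemiringSum semiring
    using (sum; sum-cong-≋; sum-init-last; ∑-distrib-+; sum⁺-syntax)
  open SemiringSolver commutativeSemiring using (solve; _:=_; _:+_; _:*_)
  open SetoidReasoning setoid

  -- Characteristic zero

  1/-inverseˡ : ∀ n .{{_ : NonZero n}} → 1/ n * (n × 1#) ≈ 1#
  1/-inverseˡ n = begin
    1/ n * (n × 1#)         ≈⟨ *-congˡ (x-0≈x _) ⟨
    1/ n * (n × 1# - 0#)    ≈⟨ proj₁ (proj₂ (#⇒invertible (characteristicZero n))) ⟩
    1#                      ∎

  ×1-cancelˡ-zero : ∀ n .{{_ : NonZero n}} {x} → (n × 1#) * x ≈ 0# → x ≈ 0#
  ×1-cancelˡ-zero n {x} nx≈0 = begin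
    x                       ≈⟨ *-identityˡ x ⟨
    1# * x                  ≈⟨ *-congʳ (1/-inverseˡ n) ⟨
    1/ n * (n × 1#) * x     ≈⟨ *-assoc _ _ _ ⟩
    1/ n * ((n × 1#) * x)   ≈⟨ *-congˡ nx≈0 ⟩
    1/ n * 0#               ≈⟨ zeroʳ _ ⟩
    0#                      ∎

  -- This recovers the natural number `m` from the class of `d - n`, so that different witnesses of
  -- `IsNatural` can be compared.
  ×1-injective : ∀ m n → m × 1# ≈ n × 1# → m ≡ n
  ×1-injective zero    zero    _  = ≡.refl
  ×1-injective zero    (suc n) eq = ⊥-elim (#-irrefl (sym eq) (characteristicZero (suc n)))
  ×1-injective (suc m) zero    eq = ⊥-elim (#-irrefl eq (characteristicZero (suc m)))
  ×1-injective (suc m) (suc n) eq =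
    ≡.cong suc (×1-injective m n (+-cancelˡ 1# _ _ eq))

  -- Meant for `m = suc k` and `n = k !`, where it turns a factor `suc k` over `suc k !` into
  -- `1/ (k !)` in Pascal's rule.
  1/-*-cancel : ∀ m n .{{_ : NonZero m}} .{{_ : NonZero n}} .{{_ : NonZero (m ℕ.* n)}} →
                1/ (m ℕ.* n) * (m × 1#) ≈ 1/ n
  1/-*-cancel m n = begin
    u * (m × 1#)                            ≈⟨ *-identityʳ _ ⟨
    u * (m × 1#) * 1#                       ≈⟨ *-congˡ (1/-inverseˡ n) ⟨
    u * (m × 1#) * (1/ n * (n × 1#))        ≈⟨ solve 4 (λ u m v n → u :* m :* (v :* n) := u :* (m :* n) :* v) refl u _ _ _ ⟩
    u * ((m × 1#) * (n × 1#)) * 1/ n        ≈⟨ *-congʳ (*-congˡ (×1-homo-* m n)) ⟨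
    u * ((m ℕ.* n) × 1#) * 1/ n             ≈⟨ *-congʳ (1/-inverseˡ (m ℕ.* n)) ⟩
    1# * 1/ n                               ≈⟨ *-identityˡ _ ⟩
    1/ n                                    ∎
    where u = 1/ (m ℕ.* n)

  -- Rearranging sums and differences

  -‿cong₂ : ∀ {x x′ y y′} → x ≈ x′ → y ≈ y′ → x - y ≈ x′ - y′
  -‿cong₂ x≈x′ y≈y′ = +-cong x≈x′ (-‿cong y≈y′)

  x-y+y≈x : ∀ x y → x - y + y ≈ x
  x-y+y≈x x y = begin
    x - y + y       ≈⟨ +-assoc _ _ _ ⟩
    x + (- y + y)   ≈⟨ +-congˡ (-‿inverseˡ y) ⟩
    x + 0#          ≈⟨ +-identityʳ x ⟩
    x               ∎

  x-[y+z]≈x-y-z : ∀ x y z → x - (y + z) ≈ x - y - z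
  x-[y+z]≈x-y-z x y z = begin
    x - (y + z)       ≈⟨ +-congˡ (-‿+-comm y z) ⟨
    x + (- y + - z)   ≈⟨ +-assoc _ _ _ ⟨
    x - y - z         ∎

  x+y-z≈x-z+y : ∀ x y z → x + y - z ≈ x - z + y
  x+y-z≈x-z+y x y z = solve 3 (λ x y z → x :+ y :+ z := x :+ z :+ y) refl x y (- z)

  [x+y]-[y+z]≈x-z : ∀ x y z → (x + y) - (y + z) ≈ x - z
  [x+y]-[y+z]≈x-z x y z = begin
    (x + y) - (y + z)   ≈⟨ x-[y+z]≈x-y-z _ _ _ ⟩
    x + y - y - z       ≈⟨ +-congʳ (x+y-z≈x-z+y x y y) ⟩
    x - y + y - z       ≈⟨ +-congʳ (x-y+y≈x x y) ⟩
    x - z               ∎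

  -- Binomial coefficients of field elements

  falling : Carrier → ℕ → Carrier
  falling z zero    = 1#
  falling z (suc k) = falling z k * (z - k × 1#)

  binom : Carrier → ℕ → Carrier
  binom z k = 1/ (k !) {{k !≢0}} * falling z k

  falling-cong : ∀ {y z} k → y ≈ z → falling y k ≈ falling z k
  falling-cong zero    y≈z = refl
  falling-cong (suc k) y≈z = *-cong (falling-cong k y≈z) (+-congʳ y≈z)

  binom-cong : ∀ {y z} k → y ≈ z → binom y k ≈ binom z k
  binom-cong k y≈z = *-congˡ (falling-cong k y≈z)

  -- The definition splits off the lowest factor; induction is needed to split off the highest one,
  -- because the remaining factors are those of `falling z k`.
  falling-suc : ∀ z k → falling (z + 1#) (suc k) ≈ (z + 1#) * falling z k
  falling-suc z zero = begin
    1# * (z + 1# - 0#)   ≈⟨ *-congˡ (x-0≈x _) ⟩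
    1# * (z + 1#)        ≈⟨ *-comm _ _ ⟩
    (z + 1#) * 1#        ∎
  falling-suc z (suc k) = begin
    falling (z + 1#) (suc k) * (z + 1# - suc k × 1#)
      ≈⟨ *-cong (falling-suc z k) ([x+y]-[y+z]≈x-z z 1# (k × 1#)) ⟩
    (z + 1#) * falling z k * (z - k × 1#)
      ≈⟨ *-assoc _ _ _ ⟩
    (z + 1#) * falling z (suc k) ∎

  -- Splitting the top factor as `z + 1 = (z - k) + (k + 1)` yields the two summands.
  falling-pascal : ∀ z k →
    falling (z + 1#) (suc k) ≈ falling z (suc k) + (suc k × 1#) * falling z k
  falling-pascal z k = begin
    falling (z + 1#) (suc k)                      ≈⟨ falling-suc z k ⟩
    (z + 1#) * F                                  ≈⟨ *-congʳ (+-congʳ (x-y+y≈x z k̂)) ⟨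
    (z - k̂ + k̂ + 1#) * F
      ≈⟨ solve 4 (λ t k e F → (t :+ k :+ e) :* F := F :* t :+ (e :+ k) :* F)
           refl (z - k̂) k̂ 1# F ⟩
    F * (z - k̂) + (1# + k̂) * F                    ∎
    where
    k̂ = k × 1#
    F = falling z k

  binom-pascal : ∀ z k → binom (z + 1#) (suc k) ≈ binom z (suc k) + binom z k
  binom-pascal z k = begin
    u * falling (z + 1#) (suc k)
      ≈⟨ *-congˡ (falling-pascal z k) ⟩
    u * (falling z (suc k) + (suc k × 1#) * falling z k)
      ≈⟨ solve 4 (λ u G n F → u :* (G :+ n :* F) := u :* G :+ u :* n :* F) refl u _ _ _ ⟩
    u * falling z (suc k) + u * (suc k × 1#) * falling z k
      ≈⟨ +-congˡ (*-congʳ (1/-*-cancel (suc k) (k !) {{_}} {{k !≢0}} {{suc k !≢0}})) ⟩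
    binom z (suc k) + binom z k ∎
    where u = 1/ (suc k !) {{suc k !≢0}}

  -- The Jensen-type sum

  jensenTerm : ℕ → Carrier → Carrier → ℕ → Carrier
  jensenTerm m y z k = binom (y - k × 1#) k * binom (z + k × 1#) (m ∸ k)

  jensen : ℕ → Carrier → Carrier → Carrier
  jensen m y z = ∑[ i ≤ m ] jensenTerm m y z (toℕ i)

  jensenTerm-cong : ∀ m {y y′ z z′} k → y ≈ y′ → z ≈ z′ →
                    jensenTerm m y z k ≈ jensenTerm m y′ z′ k
  jensenTerm-cong m k y≈y′ z≈z′ =
    *-cong (binom-cong k (+-congʳ y≈y′)) (binom-cong (m ∸ k) (+-congʳ z≈z′))

  jensen-cong : ∀ m {y y′ z z′} → y ≈ y′ → z ≈ z′ → jensen m y z ≈ jensen m y′ z′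
  jensen-cong m y≈y′ z≈z′ =
    sum-cong-≋ {suc m} λ i → jensenTerm-cong m (toℕ i) y≈y′ z≈z′

  -- Pascal's rule for the left factor applies to the terms of positive index. Its second summands,
  -- reindexed from `suc k` to `k`, form a shorter sum; the unit freed from `suc k` moves into
  -- `y - 1#` and `z + 1#`.
  jensen-pascalˡ : ∀ m y z →
    jensen (suc m) (y + 1#) z ≈ jensen (suc m) y z + jensen m (y - 1#) (z + 1#)
  jensen-pascalˡ m y z = begin
    head + ∑[ i ≤ m ] jensenTerm (suc m) (y + 1#) z (suc (toℕ i))
      ≈⟨ +-congˡ (sum-cong-≋ {suc m} (λ i → term (toℕ i))) ⟩
    head + ∑[ i ≤ m ] (A i + B i)
      ≈⟨ +-congˡ (∑-distrib-+ {suc m} A B) ⟩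
    head + (sum {suc m} A + sum {suc m} B)
      ≈⟨ +-assoc _ _ _ ⟨
    jensen (suc m) y z + jensen m (y - 1#) (z + 1#) ∎
    where
    -- A binomial coefficient of lower index 0 does not see its upper argument, so the initial term
    -- at `y + 1#` is this one by definition.
    head = jensenTerm (suc m) y z 0
    A B : Fin (suc m) → Carrier
    A i = jensenTerm (suc m) y z (suc (toℕ i))
    B i = jensenTerm m (y - 1#) (z + 1#) (toℕ i)
    term : ∀ k → jensenTerm (suc m) (y + 1#) z (suc k) ≈
                 jensenTerm (suc m) y z (suc k) + jensenTerm m (y - 1#) (z + 1#) k
    term k = begin
      binom (y + 1# - suc k × 1#) (suc k) * Z
        ≈⟨ *-congʳ (binom-cong (suc k) (x+y-z≈x-z+y y 1# _)) ⟩
      binom (y - suc k × 1# + 1#) (suc k) * Z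
        ≈⟨ *-congʳ (binom-pascal _ k) ⟩
      (binom (y - suc k × 1#) (suc k) + binom (y - suc k × 1#) k) * Z
        ≈⟨ distribʳ _ _ _ ⟩
      jensenTerm (suc m) y z (suc k) + binom (y - suc k × 1#) k * Z
        ≈⟨ +-congˡ (*-cong (binom-cong k (x-[y+z]≈x-y-z y 1# _))
                           (binom-cong (m ∸ k) (sym (+-assoc z 1# _)))) ⟩
      jensenTerm (suc m) y z (suc k) + jensenTerm m (y - 1#) (z + 1#) k ∎
      where Z = binom (z + suc k × 1#) (m ∸ k)

  -- Pascal's rule for the right factor needs a positive lower index `suc m ∸ k`, so the term
  -- `k = suc m` is split off and treated separately.
  jensen-pascalʳ : ∀ m y z →
    jensen (suc m) y (z + 1#) ≈ jensen (suc m) y z + jensen m y z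
  jensen-pascalʳ m y z = begin
    jensen (suc m) y (z + 1#)
      ≈⟨ split (z + 1#) ⟩
    ∑[ i ≤ m ] jensenTerm (suc m) y (z + 1#) (toℕ i) + last
      ≈⟨ +-congʳ (sum-cong-≋ {suc m} (λ i → term (toℕ i) (toℕ≤pred[n] i))) ⟩
    ∑[ i ≤ m ] (A i + B i) + last
      ≈⟨ +-congʳ (∑-distrib-+ {suc m} A B) ⟩
    sum {suc m} A + sum {suc m} B + last
      ≈⟨ solve 3 (λ a b l → a :+ b :+ l := a :+ l :+ b) refl (sum {suc m} A) (sum {suc m} B) last ⟩
    sum {suc m} A + last + sum {suc m} B
      ≈⟨ +-congʳ (split z) ⟨
    jensen (suc m) y z + jensen m y z ∎
    where
    A B : Fin (suc m) → Carrier
    A i = jensenTerm (suc m) y z (toℕ i)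
    B i = jensenTerm m y z (toℕ i)

    -- The last term does not depend on z.
    last = binom (y - suc m × 1#) (suc m) * binom 0# 0

    split : ∀ z → jensen (suc m) y z ≈ ∑[ i ≤ m ] jensenTerm (suc m) y z (toℕ i) + last
    split z = begin
      jensen (suc m) y z
        ≈⟨ sum-init-last {suc m} (jensenTerm (suc m) y z ∘ toℕ) ⟩
      ∑[ i ≤ m ] jensenTerm (suc m) y z (toℕ (inject₁ i)) + jensenTerm (suc m) y z (toℕ (fromℕ (suc m)))
        ≈⟨ +-cong
             (sum-cong-≋ {suc m} (λ i → reflexive (≡.cong (jensenTerm (suc m) y z) (toℕ-inject₁ i))))
             (reflexive (≡.cong (jensenTerm (suc m) y z) (toℕ-fromℕ (suc m)))) ⟩
      ∑[ i ≤ m ] jensenTerm (suc m) y z (toℕ i) + jensenTerm (suc m) y z (suc m)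
        -- Once the lower index is 0, the right factor equals `binom 0# 0` by definition.
        ≈⟨ +-congˡ (*-congˡ (reflexive (≡.cong (binom (z + suc m × 1#)) (ℕ.n∸n≡0 m)))) ⟩
      ∑[ i ≤ m ] jensenTerm (suc m) y z (toℕ i) + last ∎

    term : ∀ k → k ℕ.≤ m →
           jensenTerm (suc m) y (z + 1#) k ≈ jensenTerm (suc m) y z k + jensenTerm m y z k
    -- For `k ≤ m` the truncated difference `suc m ∸ k` is `suc (m ∸ k)`, the form that Pascal's
    -- rule requires.
    term k k≤m rewrite ℕ.+-∸-assoc 1 k≤m = begin
      Y * binom (z + 1# + k × 1#) (suc (m ∸ k))
        ≈⟨ *-congˡ (binom-cong (suc (m ∸ k))
             (solve 3 (λ z e k → z :+ e :+ k := z :+ k :+ e) refl z 1# (k × 1#))) ⟩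
      Y * binom (z + k × 1# + 1#) (suc (m ∸ k))
        ≈⟨ *-congˡ (binom-pascal _ (m ∸ k)) ⟩
      Y * (binom (z + k × 1#) (suc (m ∸ k)) + binom (z + k × 1#) (m ∸ k))
        ≈⟨ distribˡ _ _ _ ⟩
      Y * binom (z + k × 1#) (suc (m ∸ k)) + jensenTerm m y z k ∎
      where Y = binom (y - k × 1#) k

  jensen-shift : ∀ m y z → jensen m (y + 1#) z ≈ jensen m y (z + 1#)
  -- The only term is a product of two coefficients of lower index 0, in which neither `y` nor `z`
  -- survives.
  jensen-shift zero    y z = refl
  jensen-shift (suc m) y z = begin
    jensen (suc m) (y + 1#) z
      ≈⟨ jensen-pascalˡ m y z ⟩
    jensen (suc m) y z + jensen m (y - 1#) (z + 1#)
      -- The induction hypothesis at `y - 1#` makes the lower-order sums of the two Pascal rules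
      -- agree.
      ≈⟨ +-congˡ (jensen-shift m (y - 1#) z) ⟨
    jensen (suc m) y z + jensen m (y - 1# + 1#) z
      ≈⟨ +-congˡ (jensen-cong m (x-y+y≈x y 1#) refl) ⟩
    jensen (suc m) y z + jensen m y z
      ≈⟨ jensen-pascalʳ m y z ⟨
    jensen (suc m) y (z + 1#) ∎

  -- Iterating the shift moves `j` units from `z` to `y`; for `f` this compares the values at `j`
  -- and at 0.
  jensen-×1 : ∀ m y z j → jensen m (y + j × 1#) (z - j × 1#) ≈ jensen m y z
  jensen-×1 m y z zero    = jensen-cong m (+-identityʳ y) (x-0≈x z)
  jensen-×1 m y z (suc j) = begin
    jensen m (y + (1# + ĵ)) (z - (1# + ĵ))
      ≈⟨ jensen-cong m
           (solve 3 (λ y e j → y :+ (e :+ j) := y :+ j :+ e) refl y 1# ĵ)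
           (trans (+-congˡ (-‿cong (+-comm 1# ĵ))) (x-[y+z]≈x-y-z z ĵ 1#)) ⟩
    jensen m (y + ĵ + 1#) (z - ĵ - 1#)
      ≈⟨ jensen-shift m (y + ĵ) (z - ĵ - 1#) ⟩
    jensen m (y + ĵ) (z - ĵ - 1# + 1#)
      ≈⟨ jensen-cong m refl (x-y+y≈x (z - ĵ) 1#) ⟩
    jensen m (y + ĵ) (z - ĵ)
      ≈⟨ jensen-×1 m y z j ⟩
    jensen m y z ∎
    where ĵ = j × 1#

  -- Evaluation of polynomials

  eval : Poly → Carrier → Carrier
  eval []      x = 0#
  eval (s ∷ p) x = s + x * eval p x

  eval-const : ∀ s x → eval (const s) x ≈ s
  eval-const s x = trans (+-congˡ (zeroʳ x)) (+-identityʳ s)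

  eval-X : ∀ x → eval X x ≈ x
  eval-X x = begin
    0# + x * eval (const 1#) x   ≈⟨ +-identityˡ _ ⟩
    x * eval (const 1#) x        ≈⟨ *-congˡ (eval-const 1# x) ⟩
    x * 1#                       ≈⟨ *-identityʳ x ⟩
    x                            ∎

  eval-+ : ∀ p q x → eval (p +ₚ q) x ≈ eval p x + eval q x
  eval-+ []      q       x = sym (+-identityˡ _)
  eval-+ (s ∷ p) []      x = sym (+-identityʳ _)
  eval-+ (s ∷ p) (t ∷ q) x = begin
    s + t + x * eval (p +ₚ q) x
      ≈⟨ +-congˡ (*-congˡ (eval-+ p q x)) ⟩
    s + t + x * (eval p x + eval q x)
      ≈⟨ solve 5 (λ s t x P Q → s :+ t :+ x :* (P :+ Q) := (s :+ x :* P) :+ (t :+ x :* Q))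
           refl s t x (eval p x) (eval q x) ⟩
    (s + x * eval p x) + (t + x * eval q x) ∎

  eval-neg : ∀ p x → eval (-ₚ p) x ≈ - eval p x
  eval-neg []      x = sym -0#≈0#
  eval-neg (s ∷ p) x = begin
    - s + x * eval (-ₚ p) x    ≈⟨ +-congˡ (*-congˡ (eval-neg p x)) ⟩
    - s + x * - eval p x       ≈⟨ +-congˡ (-‿distribʳ-* x (eval p x)) ⟨
    - s + - (x * eval p x)     ≈⟨ -‿+-comm s _ ⟩
    - (s + x * eval p x)       ∎

  eval-- : ∀ p q x → eval (p -ₚ q) x ≈ eval p x - eval q x
  eval-- p q x = trans (eval-+ p (-ₚ q) x) (+-congˡ (eval-neg q x))

  eval-∙ : ∀ s p x → eval (s ∙ₚ p) x ≈ s * eval p x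
  eval-∙ s []      x = sym (zeroʳ s)
  eval-∙ s (t ∷ p) x = begin
    s * t + x * eval (s ∙ₚ p) x   ≈⟨ +-congˡ (*-congˡ (eval-∙ s p x)) ⟩
    s * t + x * (s * eval p x)
      ≈⟨ solve 4 (λ s t x P → s :* t :+ x :* (s :* P) := s :* (t :+ x :* P)) refl s t x (eval p x) ⟩
    s * (t + x * eval p x)        ∎

  eval-* : ∀ p q x → eval (p *ₚ q) x ≈ eval p x * eval q x
  eval-* []      q x = sym (zeroˡ _)
  eval-* (s ∷ p) q x = begin
    eval (s ∙ₚ q +ₚ (0# ∷ (p *ₚ q))) x
      ≈⟨ eval-+ (s ∙ₚ q) (0# ∷ (p *ₚ q)) x ⟩
    eval (s ∙ₚ q) x + (0# + x * eval (p *ₚ q) x)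
      ≈⟨ +-cong (eval-∙ s q x) (trans (+-identityˡ _) (*-congˡ (eval-* p q x))) ⟩
    s * eval q x + x * (eval p x * eval q x)
      ≈⟨ solve 4 (λ s x P Q → s :* Q :+ x :* (P :* Q) := (s :+ x :* P) :* Q)
           refl s x (eval p x) (eval q x) ⟩
    (s + x * eval p x) * eval q x ∎

  eval-sum : ∀ {n} (p : Fin n → Poly) x →
             eval (RawSemiringDefinitions.sum (RawRing.rawSemiring polyRawRing) p) x ≈ sum (λ i → eval (p i) x)
  eval-sum {zero}  p x = refl
  eval-sum {suc n} p x =
    trans (eval-+ (p Fin.zero) _ x) (+-congˡ (eval-sum (p ∘ Fin.suc) x))

  eval-fallingFactorial : ∀ p k x → eval (fallingFactorial p k) x ≈ falling (eval p x) k
  eval-fallingFactorial p zero    x = eval-const 1# x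
  eval-fallingFactorial p (suc k) x = begin
    eval (fallingFactorial p k *ₚ (p -ₚ nat k)) x
      ≈⟨ eval-* (fallingFactorial p k) (p -ₚ nat k) x ⟩
    eval (fallingFactorial p k) x * eval (p -ₚ nat k) x
      ≈⟨ *-cong (eval-fallingFactorial p k x)
           (trans (eval-- p (nat k) x) (-‿cong₂ refl (eval-const _ x))) ⟩
    falling (eval p x) (suc k) ∎

  eval-binomial : ∀ p k x → eval (binomial p k) x ≈ binom (eval p x) k
  eval-binomial p k x =
    trans (eval-∙ _ (fallingFactorial p k) x) (*-congˡ (eval-fallingFactorial p k x))

  eval-f : ∀ a d n (d-n∈ℕ : IsNatural (d - n)) x →
           eval (f a d n d-n∈ℕ) x ≈ jensen (proj₁ d-n∈ℕ) (a + d + x) (d - x)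
  eval-f a d n (m , _) x =
    trans (eval-sum {suc m} (summand ∘ toℕ) x) (sum-cong-≋ {suc m} (eval-summand ∘ toℕ))
    where
    p q summand : ℕ → Poly
    p k = const a +ₚ const d +ₚ X -ₚ nat k
    q k = const d +ₚ nat k -ₚ X
    summand k = binomial (p k) k *ₚ binomial (q k) (m ∸ k)

    eval-p : ∀ k → eval (p k) x ≈ a + d + x - k × 1#
    eval-p k = begin
      eval (p k) x
        ≈⟨ eval-- (const a +ₚ const d +ₚ X) (nat k) x ⟩
      eval (const a +ₚ const d +ₚ X) x - eval (nat k) x
        ≈⟨ -‿cong₂ (eval-+ (const a +ₚ const d) X x) (eval-const _ x) ⟩
      -- The sum `const a +ₚ const d` computes to `const (a + d)`.
      eval (const (a + d)) x + eval X x - k × 1#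
        ≈⟨ +-congʳ (+-cong (eval-const (a + d) x) (eval-X x)) ⟩
      a + d + x - k × 1# ∎

    eval-q : ∀ k → eval (q k) x ≈ d - x + k × 1#
    eval-q k = begin
      eval (q k) x
        ≈⟨ eval-- (const d +ₚ nat k) X x ⟩
      eval (const (d + k × 1#)) x - eval X x
        ≈⟨ -‿cong₂ (eval-const _ x) (eval-X x) ⟩
      d + k × 1# - x
        ≈⟨ x+y-z≈x-z+y d _ x ⟩
      d - x + k × 1# ∎

    eval-summand : ∀ k → eval (summand k) x ≈ jensenTerm m (a + d + x) (d - x) k
    eval-summand k = begin
      eval (summand k) x
        ≈⟨ eval-* (binomial (p k) k) (binomial (q k) (m ∸ k)) x ⟩
      eval (binomial (p k) k) x * eval (binomial (q k) (m ∸ k)) x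
        ≈⟨ *-cong (eval-binomial (p k) k x) (eval-binomial (q k) (m ∸ k) x) ⟩
      binom (eval (p k) x) k * binom (eval (q k) x) (m ∸ k)
        ≈⟨ *-cong (binom-cong k (eval-p k)) (binom-cong (m ∸ k) (eval-q k)) ⟩
      jensenTerm m (a + d + x) (d - x) k ∎

  -- Polynomials with infinitely many roots

  -- A zero polynomial may be a nonempty list of zeros, hence the induction.
  eval-≈ₚ[] : ∀ p → p ≈ₚ [] → ∀ x → eval p x ≈ 0#
  eval-≈ₚ[] []      _   x = refl
  eval-≈ₚ[] (s ∷ p) p≈0 x = begin
    s + x * eval p x   ≈⟨ +-cong (p≈0 0) (*-congˡ (eval-≈ₚ[] p (p≈0 ∘ suc) x)) ⟩
    0# + x * 0#        ≈⟨ eval-const 0# x ⟩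
    0#                 ∎

  -- With a vanishing tail the value at any point is `s`, so a single root forces `s` to vanish.
  ∷-≈ₚ[] : ∀ s p x → eval (s ∷ p) x ≈ 0# → p ≈ₚ [] → (s ∷ p) ≈ₚ []
  ∷-≈ₚ[] s p x root p≈0 (suc i) = p≈0 i
  ∷-≈ₚ[] s p x root p≈0 zero    = begin
    s                  ≈⟨ eval-const s x ⟨
    s + x * 0#         ≈⟨ +-congˡ (*-congˡ (eval-≈ₚ[] p p≈0 x)) ⟨
    s + x * eval p x   ≈⟨ root ⟩
    0#                 ∎

  -- Synthetic division by X - r: quotient r p is the quotient of s ∷ p for
  -- every constant coefficient s.
  quotient : Carrier → Poly → Poly
  quotient r []      = []
  quotient r (s ∷ p) = eval (s ∷ p) r ∷ quotient r p

  length-quotient : ∀ r p → length (quotient r p) ≡ length p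
  length-quotient r []      = ≡.refl
  length-quotient r (s ∷ p) = ≡.cong suc (length-quotient r p)

  -- Division with remainder by X - r, the remainder being the value at `r`.
  eval-quotient : ∀ r s p x →
    eval (s ∷ p) x ≈ eval (s ∷ p) r + (x - r) * eval (quotient r p) x
  eval-quotient r s []      x = begin
    s + x * 0#                    ≈⟨ eval-const s x ⟩
    s                             ≈⟨ eval-const s r ⟨
    s + r * 0#                    ≈⟨ eval-const _ (x - r) ⟨
    s + r * 0# + (x - r) * 0#     ∎
  eval-quotient r s (t ∷ p) x = begin
    s + x * eval (t ∷ p) x
      ≈⟨ +-congˡ (*-congˡ (eval-quotient r t p x)) ⟩
    s + x * (P + (x - r) * Q)
      ≈⟨ solve 5 (λ s x P y Q → s :+ x :* (P :+ y :* Q) := s :+ (x :* P :+ y :* (x :* Q)))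
           refl s x P (x - r) Q ⟩
    s + (x * P + (x - r) * (x * Q))
      -- Only the `x` in front of `P` is rewritten as `x - r + r`: the part with `r` completes the
      -- remainder, the rest joins the multiple of `x - r`.
      ≈⟨ +-congˡ (+-congʳ (*-congʳ (x-y+y≈x x r))) ⟨
    s + ((x - r + r) * P + (x - r) * (x * Q))
      ≈⟨ solve 6 (λ s r x P y Q → s :+ ((y :+ r) :* P :+ y :* (x :* Q))
                               := s :+ r :* P :+ y :* (P :+ x :* Q))
           refl s r x P (x - r) Q ⟩
    s + r * P + (x - r) * (P + x * Q) ∎
    where
    P = eval (t ∷ p) r
    Q = eval (quotient r p) x

  -- The head of the quotient is the value of `p` at `r`, so `r` is a root of `p`; the rest of the
  -- quotient handles the tail of `p` inductively.
  quotient-≈ₚ[] : ∀ r p → quotient r p ≈ₚ [] → p ≈ₚ []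
  quotient-≈ₚ[] r []      _   = λ _ → refl
  quotient-≈ₚ[] r (s ∷ p) q≈0 = ∷-≈ₚ[] s p r (q≈0 0) (quotient-≈ₚ[] r p (q≈0 ∘ suc))

  -- Dividing by X - r leaves a shorter polynomial with roots r + 1, r + 2, ..., since the
  -- differences from `r` are invertible. The start `r` is arbitrary so that it can advance, and the
  -- recursion runs on the length because `quotient r p` is not a sublist of the dividend.
  roots⇒≈ₚ[] : ∀ l p → length p ≡ l → ∀ r → (∀ i → eval p (r + i × 1#) ≈ 0#) → p ≈ₚ []
  roots⇒≈ₚ[] l       []      _  r roots = λ _ → refl
  roots⇒≈ₚ[] (suc l) (s ∷ p) eq r roots =
    ∷-≈ₚ[] s p r root
      (quotient-≈ₚ[] r p
        (roots⇒≈ₚ[] l (quotient r p) (≡.trans (length-quotient r p) (ℕ.suc-injective eq))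
          (r + 1#) quotientRoots))
    where
    eval-cong : ∀ q {x y} → x ≈ y → eval q x ≈ eval q y
    eval-cong []      x≈y = refl
    eval-cong (t ∷ q) x≈y = +-congˡ (*-cong x≈y (eval-cong q x≈y))

    root : eval (s ∷ p) r ≈ 0#
    root = trans (eval-cong (s ∷ p) (sym (+-identityʳ r))) (roots 0)

    quotientRoots : ∀ i → eval (quotient r p) (r + 1# + i × 1#) ≈ 0#
    quotientRoots i = begin
      eval (quotient r p) (r + 1# + i × 1#)  ≈⟨ eval-cong (quotient r p) (+-assoc r 1# _) ⟩
      Q                                      ≈⟨ ×1-cancelˡ-zero (suc i) product≈0 ⟩
      0#                                     ∎
      where
      x = r + suc i × 1#
      Q = eval (quotient r p) x
      product≈0 : (suc i × 1#) * Q ≈ 0#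
      product≈0 = begin
        (suc i × 1#) * Q                  ≈⟨ *-congʳ (xyx⁻¹≈y r _) ⟨
        (x - r) * Q                       ≈⟨ +-identityˡ _ ⟨
        0# + (x - r) * Q                  ≈⟨ +-congʳ root ⟨
        eval (s ∷ p) r + (x - r) * Q      ≈⟨ eval-quotient r s p x ⟨
        eval (s ∷ p) x                    ≈⟨ roots (suc i) ⟩
        0#                                ∎

  -- The value at 0 identifies the constant coefficient with `v`. At each positive integer the tail
  -- times that integer then vanishes, so the tail has roots 1, 2, 3, ....
  constantOnℕ⇒≈ₚconst : ∀ p v → (∀ j → eval p (j × 1#) ≈ v) → p ≈ₚ const v
  constantOnℕ⇒≈ₚconst []      v p≈v zero    = p≈v 0
  constantOnℕ⇒≈ₚconst []      v p≈v (suc i) = refl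
  constantOnℕ⇒≈ₚconst (s ∷ p) v p≈v = λ where
      zero    → s≈v
      (suc i) → roots⇒≈ₚ[] (length p) p ≡.refl 1# roots i
    where
    s≈v : s ≈ v
    s≈v = begin
      s                     ≈⟨ +-identityʳ s ⟨
      s + 0#                ≈⟨ +-congˡ (zeroˡ _) ⟨
      s + 0# * eval p 0#    ≈⟨ p≈v 0 ⟩
      v                     ∎

    roots : ∀ i → eval p (suc i × 1#) ≈ 0#
    roots i = ×1-cancelˡ-zero (suc i) (+-identityʳ-unique s _ (trans (p≈v (suc i)) (sym s≈v)))

  -- The constant value of `f`

  -- The constant is the Jensen-type sum for x = 0.
  f-constant : ∀ a d n (d-n∈ℕ : IsNatural (d - n)) →
               f a d n d-n∈ℕ ≈ₚ const (jensen (proj₁ d-n∈ℕ) (a + d) d)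
  f-constant a d n d-n∈ℕ = constantOnℕ⇒≈ₚconst (f a d n d-n∈ℕ) _ λ j →
    trans (eval-f a d n d-n∈ℕ (j × 1#)) (jensen-×1 (proj₁ d-n∈ℕ) (a + d) d j)

  -- Both witnesses name the same natural number by characteristic zero, so the two sums have equal
  -- length and only their arguments need comparing.
  constant-cong : ∀ {a a′ d d′ n n′} (d-n∈ℕ : IsNatural (d - n)) (d′-n′∈ℕ : IsNatural (d′ - n′)) →
    a ≈ a′ → d ≈ d′ → n ≈ n′ →
    jensen (proj₁ d-n∈ℕ) (a + d) d ≈ jensen (proj₁ d′-n′∈ℕ) (a′ + d′) d′
  constant-cong (m , d-n≈m) (m′ , d′-n′≈m′) a≈a′ d≈d′ n≈n′
    with ×1-injective m m′ (trans (sym d-n≈m) (trans (-‿cong₂ d≈d′ n≈n′) d′-n′≈m′))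
  ... | ≡.refl = jensen-cong m (+-cong a≈a′ d≈d′) d≈d′

theorem4p2 : ∀ {c ℓ₁ ℓ₂} (K : CharacteristicZeroField c ℓ₁ ℓ₂) →
    let open CharacteristicZeroField K
        open Polynomials K
    in Σ[ value ∈ ((a d n : Carrier) → IsNatural (d - n) → Carrier) ]
         (∀ a d n (d-n∈ℕ : IsNatural (d - n)) →
            f a d n d-n∈ℕ ≈ₚ const (value a d n d-n∈ℕ))
         ∧
         (∀ {a a′ d d′ n n′} (d-n∈ℕ : IsNatural (d - n)) (d′-n′∈ℕ : IsNatural (d′ - n′)) →
            a ≈ a′ → d ≈ d′ → n ≈ n′ →
            value a d n d-n∈ℕ ≈ value a′ d′ n′ d′-n′∈ℕ)
theorem4p2 K = _ , f-constant K , constant-cong K
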